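{- The set $\{1324,2413,3142,4231\}$ of $4$-point permutations is not quasirandom-forcing.
   Context: Permutations are written in one-line notation $\pi(1)\pi(2)\cdots\pi(k)$. Pattern density $d(\sigma,\pi)$: probability that a uniformly random $|\sigma|$-subset of positions of $\pi$ induces the pattern $\sigma$. A set $S$ of permutations is quasirandom-forcing if every sequence of permutations with sizes tending to infinity and $d(\sigma,\pi_n)\to1/|\sigma|!$ for all $\sigma\in S$ has $d(\sigma,\pi_n)\to1/|\sigma|!$ for all permutations $\sigma$. -}

module Defs where

open import Data.Nat using (ℕ; zero; suc; _≤_; _<ᵇ_; _!)
open import Data.Nat.Combinatorics using (_C_)
open import Data.Nat.Properties using () renaming (_≟_ to _≟ℕ_)
open import Data.Bool using (if_then_else_)
open import Data.List using (List; []; _∷_; [_]; map; _++_; length; filter; upTo)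
open import Data.List.Properties using (≡-dec)
open import Data.List.Membership.Propositional using (_∈_)
open import Data.List.Relation.Binary.Permutation.Propositional using (_↭_)
open import Data.Integer using (+_)
open import Data.Rational using (ℚ; 0ℚ; _/_; _-_; _<_; ∣_∣)
open import Data.Product using (Σ; ∃; ∃-syntax; proj₁)
open import Relation.Binary.PropositionalEquality using (_≡_)
open import Relation.Nullary using (Dec; ¬_)
open import Relation.Binary.Definitions using (DecidableEquality)

-- A permutation of size n in one-line notation: a list that is a
-- rearrangement of 1,2,...,n.
IsPerm : List ℕ → Set
IsPerm xs = xs ↭ map suc (upTo (length xs))

Perm : Set
Perm = Σ (List ℕ) IsPerm

subseqs : {A : Set} → ℕ → List A → List (List A)
subseqs zero _ = [ [] ]
subseqs (suc k) [] = []
subseqs (suc k) (x ∷ xs) = map (x ∷_) (subseqs k xs) ++ subseqs (suc k) xs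

below : ℕ → List ℕ → ℕ
below x [] = 0
below x (y ∷ ys) = if y <ᵇ x then suc (below x ys) else below x ys

standardize : List ℕ → List ℕ
standardize xs = map (λ x → suc (below x xs)) xs

_≟L_ : DecidableEquality (List ℕ)
_≟L_ = ≡-dec _≟ℕ_

occurrences : List ℕ → List ℕ → ℕ
occurrences σ π = length (filter (λ s → standardize s ≟L σ) (subseqs (length σ) π))

divℚ : ℕ → ℕ → ℚ
divℚ a zero = 0ℚ
divℚ a (suc b) = (+ a) / suc b

density : List ℕ → List ℕ → ℚ
density σ π = divℚ (occurrences σ π) (length π C length σ)

ConvergesTo : (ℕ → ℚ) → ℚ → Set
ConvergesTo f L = ∀ (ε : ℚ) → 0ℚ < ε → ∃[ N ] (∀ n → N ≤ n → ∣ f n - L ∣ < ε)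

SizesToInfinity : (ℕ → Perm) → Set
SizesToInfinity π = ∀ (M : ℕ) → ∃[ N ] (∀ n → N ≤ n → M ≤ length (proj₁ (π n)))

randomDensity : List ℕ → ℚ
randomDensity σ = divℚ 1 (length σ !)

QuasirandomForcing : List (List ℕ) → Set
QuasirandomForcing S =
  ∀ (π : ℕ → Perm) → SizesToInfinity π →
  (∀ σ → σ ∈ S → ConvergesTo (λ n → density σ (proj₁ (π n))) (randomDensity σ)) →
  ∀ (σ : List ℕ) → IsPerm σ → ConvergesTo (λ n → density σ (proj₁ (π n))) (randomDensity σ)

{-# OPTIONS --safe #-}
module Submission where

open import Defs
open import Data.Bool using (Bool; true; false; not; if_then_else_)
open import Data.Bool.Properties using (T-≡)
open import Data.Empty using (⊥-elim)
open import Data.Integer as ℤ using (+_; -[1+_]; +[1+_]; +<+)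
import Data.Integer.Properties as ℤ
import Data.Integer.Tactic.RingSolver as ℤ-Solver
open import Data.List using (List; []; _∷_; _++_; map; concatMap; length; filter; replicate; upTo; applyUpTo; applyDownFrom; zipWith)
open import Data.List.Membership.Propositional using (_∈_)
open import Data.List.Properties using (filter-++; length-++; map-∘; map-cong; map-++; map-concatMap; concatMap-cong; concatMap-++; map-applyUpTo; map-applyDownFrom; reverse-applyUpTo; upTo-∷ʳ; map-upTo; ++-identityʳ; length-map; length-upTo)
open import Data.List.Relation.Binary.Permutation.Propositional using (_↭_; ↭-refl; ↭-sym; ↭-trans; ↭-reflexive)
import Data.List.Relation.Binary.Permutation.Propositional as ↭
open import Data.List.Relation.Binary.Permutation.Propositional.Properties using (shifts; ↭-reverse; ↭-length; ++⁺; ++⁺ˡ)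
open import Data.List.Relation.Binary.Sublist.Propositional using (_⊆_; []; _∷ʳ_; _∷_; minimum)
open import Data.List.Relation.Binary.Sublist.Propositional.Properties using (All-resp-⊆)
open import Data.List.Relation.Unary.All as All using (All; []; _∷_)
import Data.List.Relation.Unary.All.Properties as All
open import Data.List.Relation.Unary.AllPairs as AllPairs using (AllPairs; []; _∷_)
import Data.List.Relation.Unary.AllPairs.Properties as AllPairs
open import Data.List.Relation.Unary.Any using (here; there)
open import Data.Nat using (ℕ; zero; suc; _+_; _*_; _!; _<_; _≤_; _≟_; _≡ᵇ_; _<ᵇ_; z≤n; s≤s; NonZero; >-nonZero; >-nonZero⁻¹)
open import Data.Nat.Combinatorics using (_C_; nC1≡n; nCk+nC[k+1]≡[n+1]C[k+1])
open import Data.Nat.Coprimality using (Coprime; 1-coprimeTo)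
open import Data.Nat.ListAction using (sum; product)
open import Data.Nat.ListAction.Properties using (sum-++)
open import Data.Nat.Properties
open import Data.List.Sort.InsertionSort.Properties ≤-decTotalOrder using (sort-↭)
open import Data.Nat.Tactic.RingSolver using (solve-∀)
open import Data.Product using (_×_; _,_; proj₁; proj₂)
open import Data.Rational as ℚ using (mkℚ; toℚᵘ; ∣_∣)
import Data.Rational.Properties as ℚ
open import Data.Rational.Unnormalised as ℚᵘ using (mkℚᵘ)
import Data.Rational.Unnormalised.Properties as ℚᵘ
open import Data.Sum using (inj₁; inj₂)
open import Function using (_∘_; const; Equivalence)
open import Level using (0ℓ)
open import Relation.Binary.Definitions using (tri<; tri≈; tri>)
open import Relation.Binary.PropositionalEquality using (_≡_; _≢_; _≗_; refl; sym; trans; cong; cong₂; subst; subst₂; module ≡-Reasoning)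
open import Relation.Nullary using (does; ¬_; ¬?)
open import Relation.Nullary.Decidable using (from-yes)
open import Relation.Nullary.Negation using (contradiction)
open import Relation.Unary using (Pred; Decidable)

-- A permutation τ of 36 blocks, each block being replaced by a monotone run of
-- n points (increasing or decreasing according to a sign), has pattern counts
-- that are polynomials in n.  For a 4-pattern the density tends to 1/24 as soon
-- as the coefficient of n⁴ is 36⁴/24² = 2916.  Runs are separable, so 2413 and
-- 3142 only occur across four distinct blocks, while 1324 (resp. 4231) also
-- occurs as a 123 (resp. 321) of blocks whose middle one is decreasing (resp.
-- increasing) and contributes two points, at half weight.  The signed τ below,
-- found by simulated annealing, meets all four conditions exactly, but 21 has
-- limiting density 655/1296.

private
  variable
    A B : Set

-- Counting subsequences by a Boolean predicate

-- No subsequence list is built: the entries already chosen are absorbed into the predicate, so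
-- inductions must be stated for arbitrary `Q`.
count : (List A → Bool) → ℕ → List A → ℕ
count Q zero    xs       = if Q [] then 1 else 0
count Q (suc k) []       = 0
count Q (suc k) (x ∷ xs) = count (Q ∘ (x ∷_)) k xs + count Q (suc k) xs

length-filter-map : ∀ {P : Pred B 0ℓ} (P? : Decidable P) (f : A → B) xs →
                    length (filter P? (map f xs)) ≡ length (filter (P? ∘ f) xs)
length-filter-map P? f []       = refl
length-filter-map P? f (x ∷ xs) with does (P? (f x))
... | true  = cong suc (length-filter-map P? f xs)
... | false = length-filter-map P? f xs

length-filter-subseqs : ∀ {P : Pred (List A) 0ℓ} (P? : Decidable P) k xs →
                        length (filter P? (subseqs k xs)) ≡ count (does ∘ P?) k xs
length-filter-subseqs P? zero    xs with does (P? [])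
... | true  = refl
... | false = refl
length-filter-subseqs P? (suc k) []       = refl
length-filter-subseqs P? (suc k) (x ∷ xs) = begin
  length (filter P? (map (x ∷_) (subseqs k xs) ++ subseqs (suc k) xs))
    ≡⟨ cong length (filter-++ P? (map (x ∷_) (subseqs k xs)) _) ⟩
  length (filter P? (map (x ∷_) (subseqs k xs)) ++ filter P? (subseqs (suc k) xs))
    ≡⟨ length-++ (filter P? (map (x ∷_) (subseqs k xs))) ⟩
  length (filter P? (map (x ∷_) (subseqs k xs))) + length (filter P? (subseqs (suc k) xs))
    ≡⟨ cong₂ _+_
         (trans (length-filter-map P? (x ∷_) (subseqs k xs)) (length-filter-subseqs (P? ∘ (x ∷_)) k xs))
         (length-filter-subseqs P? (suc k) xs) ⟩
  count (does ∘ P? ∘ (x ∷_)) k xs + count (does ∘ P?) (suc k) xs ∎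
  where open ≡-Reasoning

-- Agreement on sublists of `xs` suffices. This lets `standardize` be replaced by `ranks`, which
-- agree on lists of consistent points, a property that sublists inherit.
count-cong-⊆ : ∀ {Q Q′ : List A → Bool} k xs → (∀ {s} → s ⊆ xs → Q s ≡ Q′ s) →
               count Q k xs ≡ count Q′ k xs
count-cong-⊆ zero    xs       eq = cong (if_then 1 else 0) (eq (minimum xs))
count-cong-⊆ (suc k) []       eq = refl
count-cong-⊆ (suc k) (x ∷ xs) eq =
  cong₂ _+_ (count-cong-⊆ k xs (eq ∘ (refl ∷_))) (count-cong-⊆ (suc k) xs (eq ∘ (x ∷ʳ_)))

count-map : ∀ (Q : List B → Bool) (f : A → B) k xs → count Q k (map f xs) ≡ count (Q ∘ map f) k xs
count-map Q f zero    xs       = refl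
count-map Q f (suc k) []       = refl
count-map Q f (suc k) (x ∷ xs) = cong₂ _+_ (count-map (Q ∘ (f x ∷_)) f k xs) (count-map Q f (suc k) xs)

AllPairs-resp-⊆ : ∀ {R : A → A → Set} {xs ys} → xs ⊆ ys → AllPairs R ys → AllPairs R xs
AllPairs-resp-⊆ []         []       = []
AllPairs-resp-⊆ (y ∷ʳ s)   (_ ∷ ps) = AllPairs-resp-⊆ s ps
AllPairs-resp-⊆ (refl ∷ s) (p ∷ ps) = All-resp-⊆ s p ∷ AllPairs-resp-⊆ s ps

-- Subsequences of a blow-up, summed over compositions

-- Σ_{i ≤ k} C(n, j + i) · #{(k ∸ i)-subsequences s of R with Q (b^(j + i) ++ s)}
blockSum : ℕ → A → List A → ℕ → ℕ → (List A → Bool) → ℕ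
blockSum n b R j zero    Q = (n C j) * count (Q ∘ (replicate j b ++_)) 0 R
blockSum n b R j (suc k) Q = blockSum n b R (suc j) k Q + (n C j) * count (Q ∘ (replicate j b ++_)) (suc k) R

-- The first copy of `b` is either taken or skipped, which is Pascal's rule in each term. The index
-- starts at `suc j` because Pascal's rule concerns C(n + 1, i) with i positive; the term with i = 0
-- is treated separately in `count-replicate-++`.
blockSum-pascal : ∀ n (b : A) R j k Q →
  blockSum (suc n) b R (suc j) k Q ≡ blockSum n b R j k (Q ∘ (b ∷_)) + blockSum n b R (suc j) k Q
blockSum-pascal n b R j zero Q = begin
  (suc n C suc j) * c                ≡⟨ cong (_* c) (nCk+nC[k+1]≡[n+1]C[k+1] n j) ⟨
  ((n C j) + (n C suc j)) * c        ≡⟨ *-distribʳ-+ c (n C j) (n C suc j) ⟩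
  (n C j) * c + (n C suc j) * c      ∎
  where
  open ≡-Reasoning
  c = count (Q ∘ (b ∷_) ∘ (replicate j b ++_)) 0 R
blockSum-pascal n b R j (suc k) Q = begin
  blockSum (suc n) b R (suc (suc j)) k Q + (suc n C suc j) * c
    ≡⟨ cong₂ (λ u v → u + v * c) (blockSum-pascal n b R (suc j) k Q) (sym (nCk+nC[k+1]≡[n+1]C[k+1] n j)) ⟩
  (x + y) + ((n C j) + (n C suc j)) * c
    ≡⟨ rearrange x y (n C j) (n C suc j) c ⟩
  (x + (n C j) * c) + (y + (n C suc j) * c) ∎
  where
  open ≡-Reasoning
  c = count (Q ∘ (b ∷_) ∘ (replicate j b ++_)) (suc k) R
  x = blockSum n b R (suc j) k (Q ∘ (b ∷_))
  y = blockSum n b R (suc (suc j)) k Q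
  rearrange : ∀ x y p q c → (x + y) + (p + q) * c ≡ (x + p * c) + (y + q * c)
  rearrange = solve-∀

blockSum-zero : ∀ (b : A) R j k Q → blockSum 0 b R (suc j) k Q ≡ 0
blockSum-zero b R j zero    Q = refl
blockSum-zero b R j (suc k) Q = trans (+-identityʳ _) (blockSum-zero b R (suc j) k Q)

-- A Vandermonde-type identity: subsequences are sorted by the number of copies of `b` they take.
count-replicate-++ : ∀ n (b : A) R k Q → count Q k (replicate n b ++ R) ≡ blockSum n b R 0 k Q
count-replicate-++ zero    b R zero    Q = sym (*-identityˡ _)
count-replicate-++ zero    b R (suc k) Q = sym (cong₂ _+_ (blockSum-zero b R 0 k Q) (*-identityˡ _))
count-replicate-++ (suc n) b R zero    Q = sym (*-identityˡ _)
count-replicate-++ (suc n) b R (suc k) Q = begin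
  count (Q ∘ (b ∷_)) k (replicate n b ++ R) + count Q (suc k) (replicate n b ++ R)
    ≡⟨ cong₂ _+_ (count-replicate-++ n b R k (Q ∘ (b ∷_))) (count-replicate-++ n b R (suc k) Q) ⟩
  blockSum n b R 0 k (Q ∘ (b ∷_)) + (blockSum n b R 1 k Q + 1 * count Q (suc k) R)
    ≡⟨ +-assoc (blockSum n b R 0 k (Q ∘ (b ∷_))) _ _ ⟨
  blockSum n b R 0 k (Q ∘ (b ∷_)) + blockSum n b R 1 k Q + 1 * count Q (suc k) R
    ≡⟨ cong (_+ 1 * count Q (suc k) R) (blockSum-pascal n b R 0 k Q) ⟨
  blockSum (suc n) b R 1 k Q + 1 * count Q (suc k) R ∎
  where open ≡-Reasoning

-- The compositions of j + k whose first part is at least j.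
compositionsFrom : ℕ → ℕ → List (List ℕ)
compositionsFrom j zero    = (j ∷ []) ∷ []
compositionsFrom j (suc k) = compositionsFrom (suc j) k ++ map (j ∷_) (compositionsFrom 1 k)

compositions : ℕ → List (List ℕ)
compositions zero    = [] ∷ []
compositions (suc k) = compositionsFrom 1 k

expand : List ℕ → List A → List A
expand (j ∷ c) (x ∷ xs) = replicate j x ++ expand c xs
expand _       _        = []

choose : ℕ → List ℕ → ℕ
choose n c = product (map (n C_) c)

-- A subsequence of a blow-up is given by the blocks it meets, its shape `c` (how many points it has
-- in each), and the points chosen there. This counts the admissible choices of blocks; `choose n c`
-- counts the choices of points.
shapeCount : (List A → Bool) → List A → List ℕ → ℕ
shapeCount Q τ c = count (Q ∘ expand c) (length c) τ

-- The contribution to `shapeCount Q (b ∷ τ) c` in which `b` is the first block met; an empty shape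
-- meets no block.
headCount : (List A → Bool) → A → List A → List ℕ → ℕ
headCount Q b τ []      = 0
headCount Q b τ (j ∷ c) = shapeCount (Q ∘ (replicate j b ++_)) τ c

∑ : List A → (A → ℕ) → ℕ
∑ xs f = sum (map f xs)

∑-++ : ∀ xs ys (f : A → ℕ) → ∑ (xs ++ ys) f ≡ ∑ xs f + ∑ ys f
∑-++ xs ys f = trans (cong sum (map-++ f xs ys)) (sum-++ (map f xs) _)

∑-+ : ∀ xs (f g : A → ℕ) → ∑ xs (λ x → f x + g x) ≡ ∑ xs f + ∑ xs g
∑-+ []       f g = refl
∑-+ (x ∷ xs) f g rewrite ∑-+ xs f g = rearrange (f x) (g x) (∑ xs f) (∑ xs g)
  where
  rearrange : ∀ a b c d → a + b + (c + d) ≡ a + c + (b + d)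
  rearrange = solve-∀

∑-* : ∀ xs m (f : A → ℕ) → ∑ xs (λ x → m * f x) ≡ m * ∑ xs f
∑-* []       m f = sym (*-zeroʳ m)
∑-* (x ∷ xs) m f rewrite ∑-* xs m f = sym (*-distribˡ-+ m (f x) _)

∑-cong : ∀ xs {f g : A → ℕ} → f ≗ g → ∑ xs f ≡ ∑ xs g
∑-cong xs eq = cong sum (map-cong eq xs)

∑-map : ∀ xs (h : A → B) (f : B → ℕ) → ∑ (map h xs) f ≡ ∑ xs (f ∘ h)
∑-map xs h f = cong sum (sym (map-∘ xs))

-- Either `b` is the first block met or all blocks met lie in `τ`. For a shape with an explicit
-- first part this is how `count` computes, hence the induction along `compositionsFrom`.
compositionsFrom-∷ : ∀ n (Q : List A → Bool) b τ j k →
  ∑ (compositionsFrom j k) (λ c → choose n c * shapeCount Q (b ∷ τ) c) ≡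
  ∑ (compositionsFrom j k) (λ c → choose n c * headCount Q b τ c) +
  ∑ (compositionsFrom j k) (λ c → choose n c * shapeCount Q τ c)
compositionsFrom-∷ n Q b τ j zero =
  distrib (choose n (j ∷ [])) (headCount Q b τ (j ∷ [])) (shapeCount Q τ (j ∷ []))
  where
  distrib : ∀ w h s → w * (h + s) + 0 ≡ w * h + 0 + (w * s + 0)
  distrib = solve-∀
compositionsFrom-∷ n Q b τ j (suc k) = begin
  ∑ (us ++ vs) f                             ≡⟨ ∑-++ us vs f ⟩
  ∑ us f + ∑ vs f                            ≡⟨ cong₂ _+_ (compositionsFrom-∷ n Q b τ (suc j) k) vs-split ⟩
  (∑ us g + ∑ us h) + (∑ vs g + ∑ vs h)      ≡⟨ rearrange (∑ us g) (∑ us h) (∑ vs g) (∑ vs h) ⟩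
  (∑ us g + ∑ vs g) + (∑ us h + ∑ vs h)      ≡⟨ cong₂ _+_ (∑-++ us vs g) (∑-++ us vs h) ⟨
  ∑ (us ++ vs) g + ∑ (us ++ vs) h            ∎
  where
  open ≡-Reasoning
  us = compositionsFrom (suc j) k
  ws = compositionsFrom 1 k
  vs = map (j ∷_) ws
  f g h : List ℕ → ℕ
  f c = choose n c * shapeCount Q (b ∷ τ) c
  g c = choose n c * headCount Q b τ c
  h c = choose n c * shapeCount Q τ c
  rearrange : ∀ a b c d → (a + b) + (c + d) ≡ (a + c) + (b + d)
  rearrange = solve-∀
  vs-split : ∑ vs f ≡ ∑ vs g + ∑ vs h
  vs-split = begin
    ∑ vs f                                                ≡⟨ ∑-map ws (j ∷_) f ⟩
    ∑ ws (f ∘ (j ∷_))                                     ≡⟨ ∑-cong ws (λ c → *-distribˡ-+ (choose n (j ∷ c)) (headCount Q b τ (j ∷ c)) _) ⟩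
    ∑ ws (λ c → g (j ∷ c) + h (j ∷ c))                    ≡⟨ ∑-+ ws (g ∘ (j ∷_)) (h ∘ (j ∷_)) ⟩
    ∑ ws (g ∘ (j ∷_)) + ∑ ws (h ∘ (j ∷_))                 ≡⟨ cong₂ _+_ (∑-map ws (j ∷_) g) (∑-map ws (j ∷_) h) ⟨
    ∑ vs g + ∑ vs h                                       ∎

compositionsFrom-[] : ∀ n (Q : List A → Bool) j k →
  ∑ (compositionsFrom j k) (λ c → choose n c * shapeCount Q [] c) ≡ 0
compositionsFrom-[] n Q j zero    = trans (+-identityʳ _) (*-zeroʳ (choose n (j ∷ [])))
compositionsFrom-[] n Q j (suc k) = begin
  ∑ (us ++ map (j ∷_) ws) f    ≡⟨ ∑-++ us _ f ⟩
  ∑ us f + ∑ (map (j ∷_) ws) f ≡⟨ cong₂ _+_ (compositionsFrom-[] n Q (suc j) k) (∑-map ws (j ∷_) f) ⟩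
  ∑ ws (f ∘ (j ∷_))            ≡⟨ ∑-cong ws (λ c → *-zeroʳ (choose n (j ∷ c))) ⟩
  ∑ ws (λ _ → 0)               ≡⟨ ∑-* ws 0 (λ _ → 0) ⟩
  0                            ∎
  where
  open ≡-Reasoning
  us = compositionsFrom (suc j) k
  ws = compositionsFrom 1 k
  f : List ℕ → ℕ
  f c = choose n c * shapeCount Q [] c

blow : ℕ → List A → List A
blow n = concatMap (replicate n)

mutual
  -- The polynomial expansion in `n`: the shape counts do not depend on `n`. The recursion is mutual
  -- because what follows the first block is again a blow-up, of a shorter list.
  count-blow : ∀ n (Q : List A → Bool) k τ →
    count Q k (blow n τ) ≡ ∑ (compositions k) (λ c → choose n c * shapeCount Q τ c)
  count-blow n Q zero    τ = sym (trans (+-identityʳ _) (*-identityˡ _))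
  count-blow n Q (suc k) [] = sym (compositionsFrom-[] n Q 1 k)
  count-blow n Q (suc k) (b ∷ τ) = begin
    count Q (suc k) (replicate n b ++ blow n τ)
      ≡⟨ count-replicate-++ n b (blow n τ) (suc k) Q ⟩
    blockSum n b (blow n τ) 1 k Q + 1 * count Q (suc k) (blow n τ)
      ≡⟨ cong₂ _+_ (blockSum-compositions n Q b τ 1 k) (trans (*-identityˡ _) (count-blow n Q (suc k) τ)) ⟩
    ∑ (compositions (suc k)) (λ c → choose n c * headCount Q b τ c) +
    ∑ (compositions (suc k)) (λ c → choose n c * shapeCount Q τ c)
      ≡⟨ compositionsFrom-∷ n Q b τ 1 k ⟨
    ∑ (compositions (suc k)) (λ c → choose n c * shapeCount Q (b ∷ τ) c) ∎
    where open ≡-Reasoning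

  blockSum-compositions : ∀ n (Q : List A → Bool) b τ j k →
    blockSum n b (blow n τ) j k Q ≡ ∑ (compositionsFrom j k) (λ c → choose n c * headCount Q b τ c)
  blockSum-compositions n Q b τ j zero =
    unit (n C j) _
    where
    unit : ∀ x y → x * y ≡ x * 1 * y + 0
    unit = solve-∀
  blockSum-compositions n Q b τ j (suc k) = begin
    blockSum n b (blow n τ) (suc j) k Q + (n C j) * count Q′ (suc k) (blow n τ)
      ≡⟨ cong₂ (λ x y → x + (n C j) * y) (blockSum-compositions n Q b τ (suc j) k) (count-blow n Q′ (suc k) τ) ⟩
    ∑ us g + (n C j) * ∑ ws h
      ≡⟨ cong (λ x → ∑ us g + x) (∑-* ws (n C j) h) ⟨
    ∑ us g + ∑ ws (λ c → (n C j) * h c)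
      ≡⟨ cong (λ x → ∑ us g + x) (∑-cong ws (λ c → sym (*-assoc (n C j) (choose n c) (shapeCount Q′ τ c)))) ⟩
    ∑ us g + ∑ ws (g ∘ (j ∷_))
      ≡⟨ cong (λ x → ∑ us g + x) (∑-map ws (j ∷_) g) ⟨
    ∑ us g + ∑ (map (j ∷_) ws) g
      ≡⟨ ∑-++ us (map (j ∷_) ws) g ⟨
    ∑ (us ++ map (j ∷_) ws) g ∎
    where
    open ≡-Reasoning
    Q′ : List _ → Bool
    Q′ = Q ∘ (replicate j b ++_)
    us = compositionsFrom (suc j) k
    ws = compositionsFrom 1 k
    g h : List ℕ → ℕ
    g c = choose n c * headCount Q b τ c
    h c = choose n c * shapeCount Q′ τ c

-- Reading a pattern off block labels

-- (b , s) stands for a run whose values have rank b among the runs, increasing iff s is true.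
Block : Set
Block = ℕ × Bool

-- Whether a point of u lies below a point of v placed to its right.
ascent : Block → Block → Bool
ascent (b , s) (c , _) = if b ≡ᵇ c then s else b <ᵇ c

-- The first argument is the point further left. The values must be distinct and compare as the
-- labels predict.
Consistent : ℕ × Block → ℕ × Block → Set
Consistent (x , u) (y , v) = if ascent u v then x < y else y < x

tally : {A : Set} → (A → Bool) → List A → ℕ
tally P []       = 0
tally P (y ∷ ys) = if P y then suc (tally P ys) else tally P ys

-- The standardization computed from labels alone. `us` holds the labels already passed, in reverse
-- order, which is harmless because they are only counted.
ranks : List Block → List Block → List ℕ
ranks us []       = []
ranks us (v ∷ vs) = suc (tally (λ u → ascent u v) us + tally (not ∘ ascent v) vs) ∷ ranks (v ∷ us) vs

<⇒<ᵇ≡true : ∀ {m n} → m < n → (m <ᵇ n) ≡ true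
<⇒<ᵇ≡true = Equivalence.to T-≡ ∘ <⇒<ᵇ

≮⇒<ᵇ≡false : ∀ {m n} → ¬ m < n → (m <ᵇ n) ≡ false
≮⇒<ᵇ≡false {m} {n} m≮n with m <ᵇ n in eq
... | false = refl
... | true  = ⊥-elim (m≮n (<ᵇ⇒< m n (Equivalence.from T-≡ eq)))

consistent-<ᵇ : ∀ p q → Consistent p q → (proj₁ p <ᵇ proj₁ q) ≡ ascent (proj₂ p) (proj₂ q)
consistent-<ᵇ (_ , u) (_ , v) r with ascent u v
... | true  = <⇒<ᵇ≡true r
... | false = ≮⇒<ᵇ≡false (<-asym r)

consistent->ᵇ : ∀ p q → Consistent p q → (proj₁ q <ᵇ proj₁ p) ≡ not (ascent (proj₂ p) (proj₂ q))
consistent->ᵇ (_ , u) (_ , v) r with ascent u v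
... | true  = ≮⇒<ᵇ≡false (<-asym r)
... | false = <⇒<ᵇ≡true r

below-tally : ∀ x (P : Block → Bool) {ps} → All (λ p → (proj₁ p <ᵇ x) ≡ P (proj₂ p)) ps →
              below x (map proj₁ ps) ≡ tally P (map proj₂ ps)
below-tally x P []         = refl
below-tally x P (eq ∷ eqs) rewrite eq | below-tally x P eqs = refl

-- Generalised for induction: `ps` are the points passed and `qs` those to come. The whole list `ys`
-- enters only through `below`, so the order of `ps` is immaterial.
standardize-ranks-from : ∀ ys ps qs →
  (∀ z → below z ys ≡ below z (map proj₁ ps) + below z (map proj₁ qs)) →
  All (λ p → All (Consistent p) qs) ps → AllPairs Consistent qs →
  map (λ x → suc (below x ys)) (map proj₁ qs) ≡ ranks (map proj₂ ps) (map proj₂ qs)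
standardize-ranks-from ys ps []       eq cs []       = refl
standardize-ranks-from ys ps (q ∷ qs) eq cs (d ∷ ds) =
  cong₂ _∷_ (cong suc head) (standardize-ranks-from ys (q ∷ ps) qs eq′ (d ∷ All.map All.tail cs) ds)
  where
  open ≡-Reasoning
  x = proj₁ q
  head : below x ys ≡ tally (λ u → ascent u (proj₂ q)) (map proj₂ ps) + tally (not ∘ ascent (proj₂ q)) (map proj₂ qs)
  head = begin
    below x ys                                                ≡⟨ eq x ⟩
    below x (map proj₁ ps) + below x (x ∷ map proj₁ qs)        ≡⟨ cong (λ m → below x (map proj₁ ps) + m) self ⟩
    below x (map proj₁ ps) + below x (map proj₁ qs)            ≡⟨ cong₂ _+_
      (below-tally x (λ u → ascent u (proj₂ q)) (All.map (λ {p} c → consistent-<ᵇ p q (All.head c)) cs))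
      (below-tally x (not ∘ ascent (proj₂ q)) (All.map (λ {p} → consistent->ᵇ q p) d)) ⟩
    _ ∎
    where
    self : below x (x ∷ map proj₁ qs) ≡ below x (map proj₁ qs)
    self rewrite ≮⇒<ᵇ≡false (<-irrefl {x} refl) = refl
  eq′ : ∀ z → below z ys ≡ below z (x ∷ map proj₁ ps) + below z (map proj₁ qs)
  eq′ z rewrite eq z with x <ᵇ z
  ... | true  = +-suc _ _
  ... | false = refl

standardize-ranks : ∀ {ps} → AllPairs Consistent ps → standardize (map proj₁ ps) ≡ ranks [] (map proj₂ ps)
standardize-ranks {ps} = standardize-ranks-from (map proj₁ ps) [] ps (λ _ → refl) []

-- Inflating signed blocks into monotone runs

-- Ranks start at 0 and values at 1, so rank `b` occupies the values bn + 1, ..., bn + n. Each point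
-- carries its label.
cell : ℕ → Block → List (ℕ × Block)
cell n u@(b , s) = if s then applyUpTo pt n else applyDownFrom pt n
  where
  pt : ℕ → ℕ × Block
  pt r = suc (b * n + r) , u

points : ℕ → List Block → List (ℕ × Block)
points n = concatMap (cell n)

inflate : ℕ → List Block → List ℕ
inflate n τ = map proj₁ (points n τ)

consistent-increasing : ∀ b {x y} → x < y → Consistent (x , b , true) (y , b , true)
consistent-increasing b x<y rewrite Equivalence.to T-≡ (≡⇒≡ᵇ b b refl) = x<y

consistent-decreasing : ∀ b {x y} → y < x → Consistent (x , b , false) (y , b , false)
consistent-decreasing b y<x rewrite Equivalence.to T-≡ (≡⇒≡ᵇ b b refl) = y<x

cell-consistent : ∀ n u → AllPairs Consistent (cell n u)
cell-consistent n (b , true) = AllPairs.applyUpTo⁺₁ _ n λ i<j _ →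
  consistent-increasing b (s≤s (+-monoʳ-< (b * n) i<j))
cell-consistent n (b , false) = AllPairs.applyDownFrom⁺₁ _ n λ j<i _ →
  consistent-decreasing b (s≤s (+-monoʳ-< (b * n) j<i))

cell-All : ∀ {P : ℕ × Block → Set} n u → (∀ {r} → r < n → P (suc (proj₁ u * n + r) , u)) → All P (cell n u)
cell-All n (b , true)  h = All.applyUpTo⁺₁ _ n h
cell-All n (b , false) h = All.applyDownFrom⁺₁ _ n h

Disjoint : Block → Block → Set
Disjoint u v = proj₁ u ≢ proj₁ v

base-< : ∀ n {b c r r′} → b < c → r < n → suc (b * n + r) < suc (c * n + r′)
base-< n {b} {c} {r} {r′} b<c r<n = s≤s (<-≤-trans (+-monoʳ-< (b * n) r<n)
  (≤-trans (≤-reflexive (+-comm (b * n) n)) (≤-trans (*-monoˡ-≤ n b<c) (m≤m+n (c * n) r′))))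

disjoint-consistent : ∀ n u v → Disjoint u v → ∀ {r r′} → r < n → r′ < n →
  Consistent (suc (proj₁ u * n + r) , u) (suc (proj₁ v * n + r′) , v)
disjoint-consistent n (b , s) (c , t) b≢c r<n r′<n with b ≡ᵇ c in eq
... | true = ⊥-elim (b≢c (≡ᵇ⇒≡ b c (Equivalence.from T-≡ eq)))
... | false with <-cmp b c
...   | tri< b<c _ _ rewrite <⇒<ᵇ≡true b<c = base-< n b<c r<n
...   | tri≈ _ b≡c _ = ⊥-elim (b≢c b≡c)
...   | tri> b≮c _ c<b rewrite ≮⇒<ᵇ≡false b≮c = base-< n c<b r′<n

points-consistent : ∀ n {τ} → AllPairs Disjoint τ → AllPairs Consistent (points n τ)
points-consistent n {τ} d = AllPairs.concat⁺
  (All.map⁺ (All.universal (cell-consistent n) τ))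
  (AllPairs.map⁺ (AllPairs.map (λ {u} {v} u#v →
    cell-All n u (λ r<n → cell-All n v (λ r′<n → disjoint-consistent n u v u#v r<n r′<n))) d))

map-proj₂-cell : ∀ n u → map proj₂ (cell n u) ≡ replicate n u
map-proj₂-cell n (b , true)  = trans (map-applyUpTo _ proj₂ n) (constUp n)
  where
  constUp : ∀ m → applyUpTo (const (b , true)) m ≡ replicate m (b , true)
  constUp zero    = refl
  constUp (suc m) = cong (_ ∷_) (constUp m)
map-proj₂-cell n (b , false) = trans (map-applyDownFrom _ proj₂ n) (constDown n)
  where
  constDown : ∀ m → applyDownFrom (const (b , false)) m ≡ replicate m (b , false)
  constDown zero    = refl
  constDown (suc m) = cong (_ ∷_) (constDown m)

map-proj₂-points : ∀ n τ → map proj₂ (points n τ) ≡ blow n τ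
map-proj₂-points n τ = trans (map-concatMap proj₂ (cell n) τ) (concatMap-cong (map-proj₂-cell n) τ)

hasPattern : List ℕ → List Block → Bool
hasPattern σ us = does (ranks [] us ≟L σ)

-- The points are consistent, so the pattern of a subsequence depends only on its labels; and the
-- labels of all points form the blow-up of `τ`, to which `count-blow` applies.
occurrences-inflate : ∀ n {τ} σ → AllPairs Disjoint τ →
  occurrences σ (inflate n τ) ≡
  ∑ (compositions (length σ)) (λ c → choose n c * shapeCount (hasPattern σ) τ c)
occurrences-inflate n {τ} σ d = begin
  occurrences σ (inflate n τ)
    ≡⟨ length-filter-subseqs (λ s → standardize s ≟L σ) k (inflate n τ) ⟩
  count (λ s → does (standardize s ≟L σ)) k (inflate n τ)
    ≡⟨ count-map _ proj₁ k (points n τ) ⟩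
  count (λ s → does (standardize (map proj₁ s) ≟L σ)) k (points n τ)
    ≡⟨ count-cong-⊆ k (points n τ) (λ s⊆ → cong (λ z → does (z ≟L σ))
         (standardize-ranks (AllPairs-resp-⊆ s⊆ (points-consistent n d)))) ⟩
  count (hasPattern σ ∘ map proj₂) k (points n τ)
    ≡⟨ count-map (hasPattern σ) proj₂ k (points n τ) ⟨
  count (hasPattern σ) k (map proj₂ (points n τ))
    ≡⟨ cong (count (hasPattern σ) k) (map-proj₂-points n τ) ⟩
  count (hasPattern σ) k (blow n τ)
    ≡⟨ count-blow n (hasPattern σ) k τ ⟩
  ∑ (compositions k) (λ c → choose n c * shapeCount (hasPattern σ) τ c) ∎
  where
  open ≡-Reasoning
  k = length σ

-- Inflations of permutations are permutations

concatMap-↭ : ∀ {A B : Set} (f : A → List B) {xs ys} → xs ↭ ys → concatMap f xs ↭ concatMap f ys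
concatMap-↭ f ↭.refl                = ↭-refl
concatMap-↭ f (↭.prep x p)            = ++⁺ˡ (f x) (concatMap-↭ f p)
concatMap-↭ f (↭.swap x y p)          = ↭-trans (shifts (f x) (f y)) (++⁺ˡ (f y) (++⁺ˡ (f x) (concatMap-↭ f p)))
concatMap-↭ f (↭.trans p q)           = ↭-trans (concatMap-↭ f p) (concatMap-↭ f q)

interval : ℕ → ℕ → List ℕ
interval n b = applyUpTo (λ r → suc (b * n + r)) n

map-proj₁-cell : ∀ n u → map proj₁ (cell n u) ↭ interval n (proj₁ u)
map-proj₁-cell n (b , true)  = ↭-reflexive (map-applyUpTo _ proj₁ n)
map-proj₁-cell n (b , false) = ↭-trans
  (↭-reflexive (trans (map-applyDownFrom _ proj₁ n) (sym (reverse-applyUpTo _ n))))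
  (↭-reverse (interval n b))

applyUpTo-+ : ∀ {A : Set} (f : ℕ → A) m n → applyUpTo f (m + n) ≡ applyUpTo f m ++ applyUpTo (λ i → f (m + i)) n
applyUpTo-+ f zero    n = refl
applyUpTo-+ f (suc m) n = cong (f 0 ∷_) (applyUpTo-+ (f ∘ suc) m n)

intervals : ∀ n k → concatMap (interval n) (upTo k) ≡ map suc (upTo (k * n))
intervals n zero    = refl
intervals n (suc k) = begin
  concatMap (interval n) (upTo (suc k))              ≡⟨ cong (concatMap (interval n)) (upTo-∷ʳ k) ⟨
  concatMap (interval n) (upTo k ++ k ∷ [])          ≡⟨ concatMap-++ (interval n) (upTo k) (k ∷ []) ⟩
  concatMap (interval n) (upTo k) ++ (interval n k ++ []) ≡⟨ cong₂ _++_ (intervals n k) (++-identityʳ (interval n k)) ⟩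
  map suc (upTo (k * n)) ++ interval n k             ≡⟨ cong (_++ interval n k) (map-upTo suc (k * n)) ⟩
  applyUpTo suc (k * n) ++ interval n k              ≡⟨ applyUpTo-+ suc (k * n) n ⟨
  applyUpTo suc (k * n + n)                          ≡⟨ cong (applyUpTo suc) (+-comm (k * n) n) ⟩
  applyUpTo suc (suc k * n)                          ≡⟨ map-upTo suc (suc k * n) ⟨
  map suc (upTo (suc k * n))                         ∎
  where open ≡-Reasoning

inflate-intervals : ∀ n τ → inflate n τ ↭ concatMap (interval n) (map proj₁ τ)
inflate-intervals n []      = ↭-refl
inflate-intervals n (u ∷ τ) = ↭-trans
  (↭-reflexive (map-++ proj₁ (cell n u) (points n τ)))
  (++⁺ (map-proj₁-cell n u) (inflate-intervals n τ))

-- Sorting the blocks by rank makes their value intervals adjacent, and together they fill 1, ...,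
-- kn.
inflate-↭ : ∀ n k {τ} → map proj₁ τ ↭ upTo k → inflate n τ ↭ map suc (upTo (k * n))
inflate-↭ n k {τ} p = ↭-trans (inflate-intervals n τ)
  (↭-trans (concatMap-↭ (interval n) p) (↭-reflexive (intervals n k)))

-- Binomial coefficients against powers

-- (k + 1) C(n, k + 1) = (n ∸ k) C(n, k), with the subtraction moved to the other side.
C-absorb : ∀ n k → suc k * (n C suc k) + k * (n C k) ≡ n * (n C k)
C-absorb zero    zero    = refl
C-absorb zero    (suc k) = cong₂ _+_ (*-zeroʳ (2 + k)) (*-zeroʳ (suc k))
C-absorb (suc n) zero    = begin-equality
  (1 * (suc n C 1)) + 0 ≡⟨ trans (+-identityʳ _) (*-identityˡ (suc n C 1)) ⟩
  suc n C 1             ≡⟨ nC1≡n (suc n) ⟩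
  suc n                 ≡⟨ *-identityʳ (suc n) ⟨
  suc n * 1             ∎
  where open ≤-Reasoning
C-absorb (suc n) (suc k) = begin-equality
  (2 + k) * (suc n C (2 + k)) + suc k * (suc n C suc k)
    ≡⟨ cong₂ (λ x y → (2 + k) * x + suc k * y) (nCk+nC[k+1]≡[n+1]C[k+1] n (suc k)) (nCk+nC[k+1]≡[n+1]C[k+1] n k) ⟨
  (2 + k) * (b + c) + suc k * (a + b)
    ≡⟨ regroup k a b c ⟩
  ((2 + k) * c + suc k * b) + (suc k * b + k * a) + (a + b)
    ≡⟨ cong₂ (λ x y → x + y + (a + b)) (C-absorb n (suc k)) (C-absorb n k) ⟩
  n * b + n * a + (a + b)
    ≡⟨ collect n a b ⟩
  suc n * (a + b)
    ≡⟨ cong (suc n *_) (nCk+nC[k+1]≡[n+1]C[k+1] n k) ⟩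
  suc n * (suc n C suc k) ∎
  where
  open ≤-Reasoning
  a = n C k
  b = n C suc k
  c = n C (2 + k)
  regroup : ∀ k a b c → (2 + k) * (b + c) + suc k * (a + b) ≡ ((2 + k) * c + suc k * b) + (suc k * b + k * a) + (a + b)
  regroup = solve-∀
  collect : ∀ n a b → n * b + n * a + (a + b) ≡ suc n * (a + b)
  collect = solve-∀

C2-square : ∀ n → 2 * (n C 2) + n ≡ n * n
C2-square n = subst (λ c → 2 * (n C 2) + c ≡ n * c) (nC1≡n n)
  (trans (cong (λ c → 2 * (n C 2) + c) (sym (*-identityˡ (n C 1)))) (C-absorb n 1))

-- `C-absorb` applied for k = 3, 2, 1 in turn; the lower-order terms are kept on the left to avoid
-- subtraction.
C4-expand : ∀ n → 24 * (n C 4) + (18 * (n C 3) + 4 * n * (n C 2) + n * n * n) ≡ n * n * n * n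
C4-expand n = begin-equality
  24 * d + (18 * c + 4 * n * b + n * n * n)   ≡⟨ p1 n b c d ⟩
  6 * (4 * d + 3 * c) + (4 * n * b + n * n * n) ≡⟨ cong (λ x → 6 * x + (4 * n * b + n * n * n)) (C-absorb n 3) ⟩
  6 * (n * c) + (4 * n * b + n * n * n)       ≡⟨ p2 n b c ⟩
  2 * n * (3 * c + 2 * b) + n * n * n         ≡⟨ cong (λ x → 2 * n * x + n * n * n) (C-absorb n 2) ⟩
  2 * n * (n * b) + n * n * n                 ≡⟨ p3 n b ⟩
  n * n * (2 * b + n)                         ≡⟨ cong (n * n *_) (C2-square n) ⟩
  n * n * (n * n)                             ≡⟨ *-assoc (n * n) n n ⟨
  n * n * n * n                               ∎
  where
  open ≤-Reasoning
  b = n C 2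
  c = n C 3
  d = n C 4
  p1 : ∀ n b c d → 24 * d + (18 * c + 4 * n * b + n * n * n) ≡ 6 * (4 * d + 3 * c) + (4 * n * b + n * n * n)
  p1 = solve-∀
  p2 : ∀ n b c → 6 * (n * c) + (4 * n * b + n * n * n) ≡ 2 * n * (3 * c + 2 * b) + n * n * n
  p2 = solve-∀
  p3 : ∀ n b → 2 * n * (n * b) + n * n * n ≡ n * n * (2 * b + n)
  p3 = solve-∀

C4-error : ∀ n → 18 * (n C 3) + 4 * n * (n C 2) + n * n * n ≤ 6 * (n * n * n)
C4-error n = begin
  18 * c + 4 * n * b + n * n * n        ≡⟨ p1 n b c ⟩
  6 * (3 * c) + (4 * n * b + n * n * n) ≤⟨ +-monoˡ-≤ _ (*-monoʳ-≤ 6 (≤-trans (m≤m+n (3 * c) (2 * b)) (≤-reflexive (C-absorb n 2)))) ⟩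
  6 * (n * b) + (4 * n * b + n * n * n) ≡⟨ p2 n b ⟩
  5 * n * (2 * b) + n * n * n           ≤⟨ +-monoˡ-≤ _ (*-monoʳ-≤ (5 * n) (≤-trans (m≤m+n (2 * b) n) (≤-reflexive (C2-square n)))) ⟩
  5 * n * (n * n) + n * n * n           ≡⟨ p3 n ⟩
  6 * (n * n * n)                       ∎
  where
  open ≤-Reasoning
  b = n C 2
  c = n C 3
  p1 : ∀ n b c → 18 * c + 4 * n * b + n * n * n ≡ 6 * (3 * c) + (4 * n * b + n * n * n)
  p1 = solve-∀
  p2 : ∀ n b → 6 * (n * b) + (4 * n * b + n * n * n) ≡ 5 * n * (2 * b) + n * n * n
  p2 = solve-∀
  p3 : ∀ n → 5 * n * (n * n) + n * n * n ≡ 6 * (n * n * n)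
  p3 = solve-∀

-- Rational limits from inequalities between natural numbers

pos-*₃ : ∀ i j k → + (i * j * k) ≡ + i ℤ.* + j ℤ.* + k
pos-*₃ i j k = trans (ℤ.pos-* (i * j) k) (cong (ℤ._* + k) (ℤ.pos-* i j))

-- Unnormalised fractions give the difference an explicit numerator and denominator, with no
-- reduction to lowest terms.
divℚ-diff : ∀ a c-1 d-1 →
  toℚᵘ (divℚ a (suc c-1) ℚ.- divℚ 1 (suc d-1)) ℚᵘ.≃ mkℚᵘ (+ a) c-1 ℚᵘ.- mkℚᵘ (+ 1) d-1
divℚ-diff a c-1 d-1 = ℚᵘ.≃-trans (ℚ.toℚᵘ-homo-+ (divℚ a (suc c-1)) (ℚ.- divℚ 1 (suc d-1)))
  (ℚᵘ.+-cong (ℚ.toℚᵘ-fromℚᵘ (mkℚᵘ (+ a) c-1))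
    (ℚᵘ.≃-trans (ℚ.toℚᵘ-homo‿- (divℚ 1 (suc d-1))) (ℚᵘ.-‿cong (ℚ.toℚᵘ-fromℚᵘ (mkℚᵘ (+ 1) d-1)))))

-- The two hypotheses are the two sides of |a/c - 1/d| < (p + 1)/(q + 1), cross-multiplied and with
-- negative terms moved across.
divℚ-close : ∀ a c d p q .(cop : Coprime (suc p) (suc q)) .{{_ : NonZero c}} .{{_ : NonZero d}} →
  d * a * suc q < suc p * (c * d) + c * suc q → c * suc q < suc p * (c * d) + d * a * suc q →
  ∣ divℚ a c ℚ.- divℚ 1 d ∣ ℚ.< mkℚ +[1+ p ] q cop
divℚ-close a c@(suc c-1) d@(suc d-1) p q cop h₁ h₂ = abs (divℚ a c ℚ.- divℚ 1 d) upper lower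
  where
  ε = mkℚ +[1+ p ] q cop
  abs : ∀ x → x ℚ.< ε → ℚ.- x ℚ.< ε → ∣ x ∣ ℚ.< ε
  abs x u l with ℚ.∣p∣≡p∨∣p∣≡-p x
  ... | inj₁ eq rewrite eq = u
  ... | inj₂ eq rewrite eq = l
  shift : ∀ {x y z} → x < z + y → + x ℤ.- + y ℤ.< + z
  shift {x} {y} {z} h = subst (+ x ℤ.- + y ℤ.<_) (trans (cong (ℤ._- + y) (ℤ.pos-+ z y)) (cancel (+ z) (+ y)))
    (ℤ.+-monoˡ-< (ℤ.- + y) (+<+ h))
    where
    cancel : ∀ z y → z ℤ.+ y ℤ.- y ≡ z
    cancel = ℤ-Solver.solve-∀
  upper : divℚ a c ℚ.- divℚ 1 d ℚ.< ε
  upper = ℚ.toℚᵘ-cancel-< (ℚᵘ.<-respˡ-≃ (ℚᵘ.≃-sym (divℚ-diff a c-1 d-1)) (ℚᵘ.*<* (subst₂ ℤ._<_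
    (trans (cong₂ ℤ._-_ (pos-*₃ d a (suc q)) (ℤ.pos-* c (suc q))) (rearrange (+ a) (+ c) (+ d) (+ suc q)))
    (ℤ.pos-* (suc p) (c * d)) (shift {z = suc p * (c * d)} h₁))))
    where
    rearrange : ∀ a c d q → d ℤ.* a ℤ.* q ℤ.- c ℤ.* q ≡ (a ℤ.* d ℤ.+ (ℤ.- (+ 1)) ℤ.* c) ℤ.* q
    rearrange = ℤ-Solver.solve-∀
  lower : ℚ.- (divℚ a c ℚ.- divℚ 1 d) ℚ.< ε
  lower = ℚ.toℚᵘ-cancel-< (ℚᵘ.<-respˡ-≃
    (ℚᵘ.≃-sym (ℚᵘ.≃-trans (ℚ.toℚᵘ-homo‿- (divℚ a c ℚ.- divℚ 1 d)) (ℚᵘ.-‿cong (divℚ-diff a c-1 d-1)))) (ℚᵘ.*<* (subst₂ ℤ._<_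
    (trans (cong₂ ℤ._-_ (ℤ.pos-* c (suc q)) (pos-*₃ d a (suc q))) (rearrange (+ a) (+ c) (+ d) (+ suc q)))
    (ℤ.pos-* (suc p) (c * d)) (shift {z = suc p * (c * d)} h₂))))
    where
    rearrange : ∀ a c d q → c ℤ.* q ℤ.- d ℤ.* a ℤ.* q ≡ (ℤ.- (a ℤ.* d ℤ.+ (ℤ.- (+ 1)) ℤ.* c)) ℤ.* q
    rearrange = ℤ-Solver.solve-∀

-- The inequalities say n |d a(n) - c(n)| ≤ B c(n), so the error is at most B/(dn) for positive n.
-- The denominator may vanish at n = 0.
convergesTo-unitFraction : ∀ (a c : ℕ → ℕ) d B .{{_ : NonZero d}} → (∀ n → NonZero (c (suc n))) →
  (∀ n → n * (d * a n) ≤ n * c n + B * c n) → (∀ n → n * c n ≤ n * (d * a n) + B * c n) →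
  ConvergesTo (λ n → divℚ (a n) (c n)) (divℚ 1 d)
convergesTo-unitFraction a c d@(suc _) B c≢0 h₁ h₂ (mkℚ (+ 0) q cop) (ℚ.*<* (+<+ ()))
convergesTo-unitFraction a c d@(suc _) B c≢0 h₁ h₂ (mkℚ -[1+ _ ] q cop) (ℚ.*<* ())
-- For n > B(q + 1) the error is below 1/(q + 1), which is at most ε.
convergesTo-unitFraction a c d@(suc d-1) B c≢0 h₁ h₂ (mkℚ +[1+ p ] q cop) _ = suc (B * suc q) , close
  where
  step : ∀ n x y e → B * suc q < n → n * x ≤ n * y + B * e → 0 < e → e * n ≤ n * (suc p * (e * d)) →
         x * suc q < suc p * (e * d) + y * suc q
  step n x y e Bq<n le 0<e le′ = *-cancelˡ-< n _ _ (begin-strict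
    n * (x * suc q)                             ≡⟨ *-assoc n x (suc q) ⟨
    n * x * suc q                               ≤⟨ *-monoˡ-≤ (suc q) le ⟩
    (n * y + B * e) * suc q                     ≡⟨ regroup n y B e (suc q) ⟩
    e * (B * suc q) + n * (y * suc q)           <⟨ +-monoˡ-< _ (*-monoʳ-< e {{>-nonZero 0<e}} Bq<n) ⟩
    e * n + n * (y * suc q)                     ≤⟨ +-monoˡ-≤ _ le′ ⟩
    n * (suc p * (e * d)) + n * (y * suc q)     ≡⟨ *-distribˡ-+ n (suc p * (e * d)) (y * suc q) ⟨
    n * (suc p * (e * d) + y * suc q)           ∎)
    where
    open ≤-Reasoning
    regroup : ∀ n y B e s → (n * y + B * e) * s ≡ e * (B * s) + n * (y * s)
    regroup = solve-∀
  close : ∀ n → suc (B * suc q) ≤ n → ∣ divℚ (a n) (c n) ℚ.- divℚ 1 d ∣ ℚ.< mkℚ +[1+ p ] q cop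
  close n@(suc n-1) Bq<n = divℚ-close (a n) (c n) d p q cop {{c≢0 n-1}}
    (step n (d * a n) (c n) (c n) Bq<n (h₁ n) (>-nonZero⁻¹ _ {{c≢0 n-1}}) bound)
    (step n (c n) (d * a n) (c n) Bq<n (h₂ n) (>-nonZero⁻¹ _ {{c≢0 n-1}}) bound)
    where
    bound : c n * n ≤ n * (suc p * (c n * d))
    bound = ≤-trans (≤-reflexive (*-comm (c n) n)) (*-monoʳ-≤ n (≤-trans (m≤m*n (c n) d) (m≤n*m (c n * d) (suc p))))

p≤∣p∣ : ∀ p → p ℚ.≤ ∣ p ∣
p≤∣p∣ (mkℚ (+ _)    _ _) = ℚ.≤-refl
p≤∣p∣ (mkℚ -[1+ _ ] _ _) = ℚ.*≤* ℤ.-≤+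

-- Converse of the upper half of `divℚ-close`; it turns the alleged convergence of the density of 21
-- into an inequality that can be refuted.
divℚ-close⁻ : ∀ a c d p q .(cop : Coprime (suc p) (suc q)) .{{_ : NonZero c}} .{{_ : NonZero d}} →
  ∣ divℚ a c ℚ.- divℚ 1 d ∣ ℚ.< mkℚ +[1+ p ] q cop → d * a * suc q < suc p * (c * d) + c * suc q
divℚ-close⁻ a c@(suc c-1) d@(suc d-1) p q cop h = unshift
  (ℚᵘ.drop-*<* (ℚᵘ.<-respˡ-≃ (divℚ-diff a c-1 d-1) (ℚ.toℚᵘ-mono-< (ℚ.≤-<-trans (p≤∣p∣ (divℚ a c ℚ.- divℚ 1 d)) h))))
  where
  unshift : (+ a ℤ.* + d ℤ.+ ℤ.- (+ 1) ℤ.* + c) ℤ.* + suc q ℤ.< +[1+ p ] ℤ.* + (c * d) →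
            d * a * suc q < suc p * (c * d) + c * suc q
  unshift lt = ℤ.drop‿+<+ (subst₂ ℤ._<_ (trans (rearrange (+ a) (+ c) (+ d) (+ suc q)) (sym (pos-*₃ d a (suc q))))
    (sym (trans (ℤ.pos-+ (suc p * (c * d)) (c * suc q)) (cong₂ ℤ._+_ (ℤ.pos-* (suc p) (c * d)) (ℤ.pos-* c (suc q)))))
    (ℤ.+-monoˡ-< (+ c ℤ.* + suc q) lt))
    where
    rearrange : ∀ a c d q → (a ℤ.* d ℤ.+ ℤ.- (+ 1) ℤ.* c) ℤ.* q ℤ.+ c ℤ.* q ≡ d ℤ.* a ℤ.* q
    rearrange = ℤ-Solver.solve-∀

-- Exact occurrence polynomials

∑-zipWith : ∀ {A : Set} (xs : List A) (f g : A → ℕ) → ∑ xs (λ x → f x * g x) ≡ sum (zipWith _*_ (map f xs) (map g xs))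
∑-zipWith []       f g = refl
∑-zipWith (x ∷ xs) f g = cong (λ s → f x * g x + s) (∑-zipWith xs f g)

length-inflate : ∀ n k τ → map proj₁ τ ↭ upTo k → length (inflate n τ) ≡ k * n
length-inflate n k τ p = trans (↭-length (inflate-↭ n k p)) (trans (length-map suc (upTo (k * n))) (length-upTo (k * n)))

inflate-isPerm : ∀ n k τ → map proj₁ τ ↭ upTo k → IsPerm (inflate n τ)
inflate-isPerm n k τ p = subst (λ m → inflate n τ ↭ map suc (upTo m)) (sym (length-inflate n k τ p)) (inflate-↭ n k p)

occurrences-shapes : ∀ n τ σ {k ns} → length σ ≡ k → AllPairs Disjoint τ →
  map (shapeCount (hasPattern σ) τ) (compositions k) ≡ ns →
  occurrences σ (inflate n τ) ≡ sum (zipWith _*_ (map (choose n) (compositions k)) ns)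
occurrences-shapes n τ σ {k} refl d eq = trans (occurrences-inflate n σ d)
  (trans (∑-zipWith (compositions k) (choose n) (shapeCount (hasPattern σ) τ))
    (cong (sum ∘ zipWith _*_ (map (choose n) (compositions k))) eq))

-- compositions 4 lists 4, 31, 22, 211, 13, 121, 112, 1111 in this order.
occurrences₄ : ∀ n τ σ A B → length σ ≡ 4 → AllPairs Disjoint τ →
  map (shapeCount (hasPattern σ) τ) (compositions 4) ≡ 0 ∷ 0 ∷ 0 ∷ 0 ∷ 0 ∷ B ∷ 0 ∷ A ∷ [] →
  2 * occurrences σ (inflate n τ) + B * (n * n * n) ≡ (2 * A + B) * (n * n * n * n)
occurrences₄ n τ σ A B len d eq = begin-equality
  2 * occurrences σ (inflate n τ) + B * (n * n * n)
    ≡⟨ cong (λ x → 2 * x + B * (n * n * n)) (occurrences-shapes n τ σ len d eq) ⟩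
  2 * sum (zipWith _*_ (map (choose n) (compositions 4)) (0 ∷ 0 ∷ 0 ∷ 0 ∷ 0 ∷ B ∷ 0 ∷ A ∷ [])) + B * (n * n * n)
    ≡⟨ cong (λ x → 2 * x + B * (n * n * n)) (select A B (n C 1) (n C 2)
         (choose n (4 ∷ [])) (choose n (3 ∷ 1 ∷ [])) (choose n (2 ∷ 2 ∷ [])) (choose n (2 ∷ 1 ∷ 1 ∷ []))
         (choose n (1 ∷ 3 ∷ [])) (choose n (1 ∷ 1 ∷ 2 ∷ []))) ⟩
  2 * (B * ((n C 1) * (n C 1) * (n C 2)) + A * ((n C 1) * (n C 1) * (n C 1) * (n C 1))) + B * (n * n * n)
    ≡⟨ cong (λ m → 2 * (B * (m * m * (n C 2)) + A * (m * m * m * m)) + B * (n * n * n)) (nC1≡n n) ⟩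
  2 * (B * (n * n * (n C 2)) + A * (n * n * n * n)) + B * (n * n * n)
    ≡⟨ regroup n (n C 2) A B ⟩
  B * (n * n * (2 * (n C 2) + n)) + 2 * A * (n * n * n * n)
    ≡⟨ cong (λ m → B * (n * n * m) + 2 * A * (n * n * n * n)) (C2-square n) ⟩
  B * (n * n * (n * n)) + 2 * A * (n * n * n * n)
    ≡⟨ collect n A B ⟩
  (2 * A + B) * (n * n * n * n) ∎
  where
  open ≤-Reasoning
  select : ∀ A B c₁ c₂ x₁ x₂ x₃ x₄ x₅ x₇ →
    x₁ * 0 + (x₂ * 0 + (x₃ * 0 + (x₄ * 0 + (x₅ * 0 +
      (c₁ * (c₂ * (c₁ * 1)) * B + (x₇ * 0 + (c₁ * (c₁ * (c₁ * (c₁ * 1))) * A + 0)))))))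
    ≡ B * (c₁ * c₁ * c₂) + A * (c₁ * c₁ * c₁ * c₁)
  select = solve-∀
  regroup : ∀ n c A B → 2 * (B * (n * n * c) + A * (n * n * n * n)) + B * (n * n * n) ≡ B * (n * n * (2 * c + n)) + 2 * A * (n * n * n * n)
  regroup = solve-∀
  collect : ∀ n A B → B * (n * n * (n * n)) + 2 * A * (n * n * n * n) ≡ (2 * A + B) * (n * n * n * n)
  collect = solve-∀

-- `compositions 2` lists 2, 11: `B` counts occurrences inside one block and `A` those across two.
-- Doubling clears the denominator of C(n, 2).
occurrences₂ : ∀ n τ σ A B → length σ ≡ 2 → AllPairs Disjoint τ →
  map (shapeCount (hasPattern σ) τ) (compositions 2) ≡ B ∷ A ∷ [] →
  2 * occurrences σ (inflate n τ) + B * n ≡ (2 * A + B) * (n * n)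
occurrences₂ n τ σ A B len d eq = begin-equality
  2 * occurrences σ (inflate n τ) + B * n
    ≡⟨ cong (λ x → 2 * x + B * n) (occurrences-shapes n τ σ len d eq) ⟩
  2 * (choose n (2 ∷ []) * B + (choose n (1 ∷ 1 ∷ []) * A + 0)) + B * n
    ≡⟨ cong (λ m → 2 * (choose n (2 ∷ []) * B + (m * (m * 1) * A + 0)) + B * n) (nC1≡n n) ⟩
  2 * ((n C 2) * 1 * B + (n * (n * 1) * A + 0)) + B * n
    ≡⟨ regroup n (n C 2) A B ⟩
  B * (2 * (n C 2) + n) + 2 * A * (n * n)
    ≡⟨ cong (λ m → B * m + 2 * A * (n * n)) (C2-square n) ⟩
  B * (n * n) + 2 * A * (n * n)
    ≡⟨ collect n A B ⟩
  (2 * A + B) * (n * n) ∎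
  where
  open ≤-Reasoning
  regroup : ∀ n c A B → 2 * (c * 1 * B + (n * (n * 1) * A + 0)) + B * n ≡ B * (2 * c + n) + 2 * A * (n * n)
  regroup = solve-∀
  collect : ∀ n A B → B * (n * n) + 2 * A * (n * n) ≡ (2 * A + B) * (n * n)
  collect = solve-∀

-- Limiting densities of 4-point patterns

-- Here 1679616 = 36⁴ and 279936 = 6 · 36³, the latter from `C4-error`.
[36n]C4-expand : ∀ n → 24 * ((36 * n) C 4) ≤ 1679616 * (n * n * n * n)
                    × 1679616 * (n * n * n * n) ≤ 24 * ((36 * n) C 4) + 279936 * (n * n * n)
[36n]C4-expand n =
  (begin
    24 * c                        ≤⟨ m≤m+n _ _ ⟩
    24 * c + x                    ≡⟨ C4-expand (36 * n) ⟩
    m * m * m * m                 ≡⟨ fourth 36 n ⟩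
    1679616 * (n * n * n * n)     ∎) ,
  (begin
    1679616 * (n * n * n * n)     ≡⟨ fourth 36 n ⟨
    m * m * m * m                 ≡⟨ C4-expand (36 * n) ⟨
    24 * c + x                    ≤⟨ +-monoʳ-≤ (24 * c) (C4-error (36 * n)) ⟩
    24 * c + 6 * (m * m * m)      ≡⟨ cong (λ y → 24 * c + y) (third 6 36 n) ⟩
    24 * c + 279936 * (n * n * n) ∎)
  where
  open ≤-Reasoning
  m = 36 * n
  c = m C 4
  x = 18 * (m C 3) + 4 * m * (m C 2) + m * m * m
  fourth : ∀ k n → k * n * (k * n) * (k * n) * (k * n) ≡ k * k * k * k * (n * n * n * n)
  fourth = solve-∀
  third : ∀ e k n → e * (k * n * (k * n) * (k * n)) ≡ e * (k * k * k) * (n * n * n)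
  third = solve-∀

n³≤n⁴ : ∀ n → n * n * n ≤ n * n * n * n
n³≤n⁴ zero      = z≤n
n³≤n⁴ n@(suc _) = m≤m*n (n * n * n) n

-- Used to bound errors of order n³ by a multiple of C(36n, 4)/n. The error term is itself at most
-- 279936 n⁴, and 24 + 279936 is well below 36⁴.
n⁴≤[36n]C4 : ∀ n → n * n * n * n ≤ (36 * n) C 4
n⁴≤[36n]C4 n = *-cancelˡ-≤ 24 (+-cancelʳ-≤ (279936 * f) (24 * f) (24 * c) (begin
  24 * f + 279936 * f              ≡⟨ *-distribʳ-+ f 24 279936 ⟨
  279960 * f                       ≤⟨ *-monoˡ-≤ f (≤ᵇ⇒≤ 279960 1679616 _) ⟩
  1679616 * f                      ≤⟨ proj₂ ([36n]C4-expand n) ⟩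
  24 * c + 279936 * (n * n * n)    ≤⟨ +-monoʳ-≤ (24 * c) (*-monoʳ-≤ 279936 (n³≤n⁴ n)) ⟩
  24 * c + 279936 * f              ∎))
  where
  open ≤-Reasoning
  f = n * n * n * n
  c = (36 * n) C 4

-- 5832 = 2 · 36⁴ / 24², and the shape 121 contributes n² C(n, 2) ~ n⁴ / 2.
density₄-converges : ∀ τ σ A B → length σ ≡ 4 → AllPairs Disjoint τ → map proj₁ τ ↭ upTo 36 →
  map (shapeCount (hasPattern σ) τ) (compositions 4) ≡ 0 ∷ 0 ∷ 0 ∷ 0 ∷ 0 ∷ B ∷ 0 ∷ A ∷ [] →
  2 * A + B ≡ 5832 → ConvergesTo (λ n → density σ (inflate n τ)) (randomDensity σ)
density₄-converges τ σ A B len d p eq AB = subst (λ k → ConvergesTo (λ n → density σ (inflate n τ)) (divℚ 1 (k !))) (sym len)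
  (convergesTo-unitFraction a c 24 K c≢0 upper lower)
  where
  open ≤-Reasoning
  a c : ℕ → ℕ
  a n = occurrences σ (inflate n τ)
  c n = length (inflate n τ) C length σ
  -- Dominates both error coefficients: 11664 = 279936 / 24 in `a-upper` and `12 * B` in `a-lower`.
  K = 11664 + 12 * B
  c≡ : ∀ n → c n ≡ (36 * n) C 4
  c≡ n = cong₂ _C_ (length-inflate n 36 τ p) len
  n⁴≤c : ∀ n → n * n * n * n ≤ c n
  n⁴≤c n = subst (n * n * n * n ≤_) (sym (c≡ n)) (n⁴≤[36n]C4 n)
  c≢0 : ∀ n → NonZero (c (suc n))
  c≢0 n = >-nonZero (≤-trans (s≤s z≤n) (n⁴≤c (suc n)))
  -- `occurrences₄` scaled by 288 = 24 · 12, since 288 · 5832 = 36⁴.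
  a-exact : ∀ n → 24 * (24 * a n + 12 * B * (n * n * n)) ≡ 1679616 * (n * n * n * n)
  a-exact n = begin-equality
    24 * (24 * a n + 12 * B * (n * n * n))   ≡⟨ factor (a n) B (n * n * n) ⟩
    288 * (2 * a n + B * (n * n * n))        ≡⟨ cong (288 *_) (trans (occurrences₄ n τ σ A B len d eq) (cong (_* (n * n * n * n)) AB)) ⟩
    288 * (5832 * (n * n * n * n))           ≡⟨ *-assoc 288 5832 (n * n * n * n) ⟨
    1679616 * (n * n * n * n)                ∎
    where
    factor : ∀ a B t → 24 * (24 * a + 12 * B * t) ≡ 24 * 12 * (2 * a + B * t)
    factor = solve-∀
  a-upper : ∀ n → 24 * a n ≤ c n + 11664 * (n * n * n)
  a-upper n = *-cancelˡ-≤ 24 (begin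
    24 * (24 * a n)                             ≤⟨ *-monoʳ-≤ 24 (m≤m+n (24 * a n) _) ⟩
    24 * (24 * a n + 12 * B * (n * n * n))      ≡⟨ a-exact n ⟩
    1679616 * (n * n * n * n)                   ≤⟨ proj₂ ([36n]C4-expand n) ⟩
    24 * ((36 * n) C 4) + 279936 * (n * n * n)  ≡⟨ factor 24 11664 ((36 * n) C 4) (n * n * n) ⟩
    24 * ((36 * n) C 4 + 11664 * (n * n * n))   ≡⟨ cong (λ x → 24 * (x + 11664 * (n * n * n))) (c≡ n) ⟨
    24 * (c n + 11664 * (n * n * n))            ∎)
    where
    factor : ∀ k l c t → k * c + k * l * t ≡ k * (c + l * t)
    factor = solve-∀
  a-lower : ∀ n → c n ≤ 24 * a n + 12 * B * (n * n * n)
  a-lower n = *-cancelˡ-≤ 24 (begin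
    24 * c n                                    ≡⟨ cong (24 *_) (c≡ n) ⟩
    24 * ((36 * n) C 4)                         ≤⟨ proj₁ ([36n]C4-expand n) ⟩
    1679616 * (n * n * n * n)                   ≡⟨ a-exact n ⟨
    24 * (24 * a n + 12 * B * (n * n * n))      ∎)
  scale : ∀ n x y k → k ≤ K → x ≤ y + k * (n * n * n) → n * x ≤ n * y + K * c n
  scale n x y k k≤K le = begin
    n * x                          ≤⟨ *-monoʳ-≤ n le ⟩
    n * (y + k * (n * n * n))      ≡⟨ push n y k ⟩
    n * y + k * (n * n * n * n)    ≤⟨ +-monoʳ-≤ (n * y) (*-mono-≤ k≤K (n⁴≤c n)) ⟩
    n * y + K * c n                ∎
    where
    push : ∀ n y k → n * (y + k * (n * n * n)) ≡ n * y + k * (n * n * n * n)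
    push = solve-∀
  upper : ∀ n → n * (24 * a n) ≤ n * c n + K * c n
  upper n = scale n (24 * a n) (c n) 11664 (m≤m+n 11664 (12 * B)) (a-upper n)
  lower : ∀ n → n * c n ≤ n * (24 * a n) + K * c n
  lower n = scale n (c n) (24 * a n) (12 * B) (m≤n+m (12 * B) 11664) (a-lower n)

-- The signed permutation and the refutation

τ : List Block
τ =
  (17 , false) ∷ (16 , true) ∷ (34 , true) ∷ (15 , true) ∷ (30 , true) ∷ (31 , true) ∷
  (7 , true) ∷ (9 , true) ∷ (10 , true) ∷ (11 , true) ∷ (0 , false) ∷ (2 , false) ∷
  (24 , true) ∷ (22 , false) ∷ (1 , false) ∷ (21 , false) ∷ (20 , false) ∷ (19 , false) ∷
  (35 , true) ∷ (18 , false) ∷ (32 , false) ∷ (12 , true) ∷ (33 , true) ∷ (13 , true) ∷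
  (14 , true) ∷ (27 , true) ∷ (28 , true) ∷ (5 , true) ∷ (6 , false) ∷ (29 , true) ∷
  (8 , true) ∷ (4 , true) ∷ (3 , true) ∷ (25 , false) ∷ (23 , false) ∷ (26 , true) ∷ []

τ-disjoint : AllPairs Disjoint τ
τ-disjoint = from-yes (AllPairs.allPairs? (λ u v → ¬? (proj₁ u ≟ proj₁ v)) τ)

-- Insertion sort of the ranks evaluates to `upTo 36`.
τ-↭ : map proj₁ τ ↭ upTo 36
τ-↭ = ↭-sym (sort-↭ (map proj₁ τ))

π : ℕ → Perm
π n = inflate n τ , inflate-isPerm n 36 τ τ-↭

-- This and the next three tables are checked by evaluating every choice of at most four blocks.
-- Here 2 · 2636 + 560 = 5832.
shapes-1324 : map (shapeCount (hasPattern (1 ∷ 3 ∷ 2 ∷ 4 ∷ [])) τ) (compositions 4) ≡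
              0 ∷ 0 ∷ 0 ∷ 0 ∷ 0 ∷ 560 ∷ 0 ∷ 2636 ∷ []
shapes-1324 = refl

shapes-2413 : map (shapeCount (hasPattern (2 ∷ 4 ∷ 1 ∷ 3 ∷ [])) τ) (compositions 4) ≡
              0 ∷ 0 ∷ 0 ∷ 0 ∷ 0 ∷ 0 ∷ 0 ∷ 2916 ∷ []
shapes-2413 = refl

shapes-3142 : map (shapeCount (hasPattern (3 ∷ 1 ∷ 4 ∷ 2 ∷ [])) τ) (compositions 4) ≡
              0 ∷ 0 ∷ 0 ∷ 0 ∷ 0 ∷ 0 ∷ 0 ∷ 2916 ∷ []
shapes-3142 = refl

shapes-4231 : map (shapeCount (hasPattern (4 ∷ 2 ∷ 3 ∷ 1 ∷ [])) τ) (compositions 4) ≡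
              0 ∷ 0 ∷ 0 ∷ 0 ∷ 0 ∷ 848 ∷ 0 ∷ 2492 ∷ []
shapes-4231 = refl

-- There are 13 decreasing runs and 321 inversions between blocks, and (2 · 321 + 13) / 36² =
-- 655/1296.
shapes-21 : map (shapeCount (hasPattern (2 ∷ 1 ∷ [])) τ) (compositions 2) ≡ 13 ∷ 321 ∷ []
shapes-21 = refl

-- With `a` inversions among `c` pairs the conclusion reads a/c ≥ 1/2 + 1/200; the limit exceeds 1/2
-- by 7/1296, which is more than 1/200.
inversions-excess : ∀ n a c → 2 * a + 13 * n ≡ 655 * (n * n) → 2 * c + 36 * n ≡ 1296 * (n * n) →
  1 * (c * 2) + c * 200 ≤ 2 * a * 200
inversions-excess n a c ha hc = +-cancelʳ-≤ (13 * n * 200) _ _ (begin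
  -- The slack makes both hypotheses fit: 1036 = 101 · 36 - 200 · 13 and 104 = 200 · 655 - 101 ·
  -- 1296.
  1 * (c * 2) + c * 200 + 13 * n * 200    ≤⟨ m≤m+n _ (1036 * n + 104 * (n * n)) ⟩
  1 * (c * 2) + c * 200 + 13 * n * 200 + (1036 * n + 104 * (n * n)) ≡⟨ p1 n c ⟩
  101 * (2 * c + 36 * n) + 104 * (n * n)  ≡⟨ cong (λ x → 101 * x + 104 * (n * n)) hc ⟩
  101 * (1296 * (n * n)) + 104 * (n * n)  ≡⟨ p2 101 1296 104 (n * n) ⟩
  131000 * (n * n)                        ≡⟨ *-assoc 200 655 (n * n) ⟩
  200 * (655 * (n * n))                   ≡⟨ cong (200 *_) ha ⟨
  200 * (2 * a + 13 * n)                  ≡⟨ p3 200 (2 * a) (13 * n) ⟩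
  2 * a * 200 + 13 * n * 200              ∎)
  where
  open ≤-Reasoning
  p1 : ∀ n c → 1 * (c * 2) + c * 200 + 13 * n * 200 + (1036 * n + 104 * (n * n)) ≡ 101 * (2 * c + 36 * n) + 104 * (n * n)
  p1 = solve-∀
  p2 : ∀ x y z t → x * (y * t) + z * t ≡ (x * y + z) * t
  p2 = solve-∀
  p3 : ∀ k x y → k * (x + y) ≡ x * k + y * k
  p3 = solve-∀

theorem20 : ¬ QuasirandomForcing ((1 ∷ 3 ∷ 2 ∷ 4 ∷ []) ∷ (2 ∷ 4 ∷ 1 ∷ 3 ∷ []) ∷ (3 ∷ 1 ∷ 4 ∷ 2 ∷ []) ∷ (4 ∷ 2 ∷ 3 ∷ 1 ∷ []) ∷ [])
theorem20 forcing = <⇒≱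
  (divℚ-close⁻ a c 2 0 199 cop {{>-nonZero 0<c}} (proj₂ limit n (n≤1+n (proj₁ limit))))
  (inversions-excess n a c
    (occurrences₂ n τ (2 ∷ 1 ∷ []) 321 13 refl τ-disjoint shapes-21) c-exact)
  where
  sizes : SizesToInfinity π
  sizes M = M , λ n M≤n → ≤-trans M≤n (subst (n ≤_) (sym (length-inflate n 36 τ τ-↭)) (m≤n*m n 36))

  densities : ∀ σ → σ ∈ _ → ConvergesTo (λ n → density σ (proj₁ (π n))) (randomDensity σ)
  densities σ (here refl) = density₄-converges τ σ 2636 560 refl τ-disjoint τ-↭ shapes-1324 refl
  densities σ (there (here refl)) = density₄-converges τ σ 2916 0 refl τ-disjoint τ-↭ shapes-2413 refl
  densities σ (there (there (here refl))) = density₄-converges τ σ 2916 0 refl τ-disjoint τ-↭ shapes-3142 refl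
  densities σ (there (there (there (here refl)))) = density₄-converges τ σ 2492 848 refl τ-disjoint τ-↭ shapes-4231 refl

  cop : Coprime 1 200
  cop = 1-coprimeTo 200

  -- Forcing is applied to 21 with ε = 1/200. The index `n` is one past the threshold, hence
  -- positive, so that `c` is nonzero.
  limit = forcing π sizes densities (2 ∷ 1 ∷ []) (↭.swap 2 1 ↭-refl) (mkℚ +[1+ 0 ] 199 cop) (ℚ.*<* (+<+ (s≤s z≤n)))
  n = suc (proj₁ limit)
  a = occurrences (2 ∷ 1 ∷ []) (inflate n τ)
  c = length (inflate n τ) C 2
  c-exact : 2 * c + 36 * n ≡ 1296 * (n * n)
  c-exact = trans (cong (λ m → 2 * (m C 2) + 36 * n) (length-inflate n 36 τ τ-↭))
    (trans (C2-square (36 * n)) (square 36 n))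
    where
    square : ∀ k n → k * n * (k * n) ≡ k * k * (n * n)
    square = solve-∀
  0<c : 0 < c
  0<c = positive n c c-exact
    where
    positive : ∀ n c .{{_ : NonZero n}} → 2 * c + 36 * n ≡ 1296 * (n * n) → 0 < c
    positive n (suc _) _  = s≤s z≤n
    -- With c = 0 the equation would give 36n = 1296n², but 36n < 1296n ≤ 1296n².
    positive n zero    eq = contradiction eq
      (<⇒≢ (<-≤-trans (*-monoˡ-< n (<ᵇ⇒< 36 1296 _)) (*-monoʳ-≤ 1296 (m≤m*n n n))))
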